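{- The invariants $T_{\mathrm{HG}}$ and $\mathcal{T}_P$ are incomparable in distinguishing power, even among $4$-uniform hypergraphs with identical global parameters. That is, there exist $4$-uniform hypergraphs $H_1,H_2$ with the same number of vertices, components, edges and total degree such that $T_{\mathrm{HG}}(H_1)=T_{\mathrm{HG}}(H_2)$ but $\mathcal{T}_P(H_1)\ne\mathcal{T}_P(H_2)$, and there exist $4$-uniform hypergraphs $H_3,H_4$ with the same number of vertices, components, edges and total degree such that $\mathcal{T}_P(H_3)=\mathcal{T}_P(H_4)$ but $T_{\mathrm{HG}}(H_3)\ne T_{\mathrm{HG}}(H_4)$. Here $\mathcal{T}_P(H)$ denotes the polymatroid Tutte polynomial $\mathcal{T}$ of the associated polymatroid $P_H$ of $H$.
   Context: A hypergraph is a pair $H=(V,E)$ where $V$ is a finite set and $E$ is a finite multiset (parallel hyperedges are allowed and treated as distinct elements of $E$) of multisets of elements of $V$, called hyperedges. For $e\in E$, $d(e)$ is the size of $e$ counted with multiplicity; it is always assumed that $d(e)>1$. $H$ is $4$-uniform if $d(e)=4$ for all $e$. Write $v(H)=|V|$. $\kappa(H)$ is the number of connected components of the bipartite incidence graph with vertex classes $V$ and $E$, in which $u\in V$ and $e\in E$ are joined by as many edges as the multiplicity of $u$ in $e$. For $A\subseteq E$ let $\kappa(A)=\kappa((V,A))$, $d(A)=\sum_{e\in A}d(e)$ (the total degree of $H$ is $d(E)$), and $|A|$ is the number of hyperedges in $A$. Hypergraph Tutte polynomial: $T_{\mathrm{HG}}(H)=T_{\mathrm{HG}}(H;x,y)=\sum_{A\subseteq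 E}(x-1)^{\kappa(A)-\kappa(H)}(y-1)^{d(A)-|A|-v(H)+\kappa(A)}$. A polymatroid is a pair $P=(E,r)$ with $E$ finite and $r:2^E\to\mathbb{Z}$ normalized ($r(\emptyset)=0$), increasing and submodular. The associated polymatroid $P_H$ has groundset $E$ and rank function $r(A)=v(H)-\kappa(A)$. The polymatroid Tutte polynomial $\mathcal{T}_P(x,y)$ (Bernardi–Kálmán–Postnikov) is given recursively: $\mathcal{T}_P=1$ if $E=\emptyset$. Otherwise fix any $e\in E$, set $\alpha_e=r(E)-r(E\setminus\{e\})$, $\beta_e=r(\{e\})$, and for each integer $\alpha_e\le j\le\beta_e$ let $P_{e,j}$ be the polymatroid on $E\setminus\{e\}$ with rank function $r_{e,j}(A)=\min\{r(A),\,r(A\cup\{e\})-j\}$ (so $P_{e,\alpha_e}=P\setminus e$ is the deletion and $P_{e,\beta_e}=P/e$ the contraction). Then $\mathcal{T}_P=(x+y-1)\mathcal{T}_{P\setminus e}$ if $\alpha_e=\beta_e$, and $\mathcal{T}_P=x\,\mathcal{T}_{P\setminus e}+y\,\mathcal{T}_{P/e}+\sum_{j=\alpha_e+1}^{\beta_e-1}\mathcal{T}_{P_{e,j}}$ if $\alpha_e<\beta_e$. It is known that the result is independent of the choices of $e$. An invariant $F_1$ is less distinguishing than $F_2$ if $F_2(H)=F_2(H')$ implies $F_1(H)=F_1(H')$ for all $H,H'$; $F_1,F_2$ are incomparable in distinguishing power if neither is less distinguishing than the other. -}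

module Defs where

open import Algebra.Bundles.Raw using (RawRing)
import Algebra.Definitions.RawSemiring as RawSemiringDefinitions
open import Data.Bool.Base using (_∨_; _∧_)
open import Data.Empty using (⊥-elim)
open import Data.Fin.Base using (Fin; zero; suc; toℕ; punchIn; punchOut)
open import Data.Fin.Properties as Fin
  using (any?; injective⇒≤; punchOut-injective; punchOut-cong; punchOut-punchIn; punchInᵢ≢i; toℕ<n)
open import Data.Fin.Subset using (Subset; Side; inside; outside; ⊥; ⊤; ⁅_⁆; _∈_; _⊆_; _∪_; _∩_; ∣_∣) renaming (_-_ to _∖_)
open import Data.Fin.Subset.Properties
  using (⊥⊆; ∉⊥; drop-∷-⊆; x∈⁅x⁆; x∈p∪q⁺; x∈p∪q⁻; x∈p∩q⁺; x∈p∩q⁻; x∈p∧x≢y⇒x∈p-y)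
open import Data.Integer.Base as ℤ using (ℤ; +_; 0ℤ; _⊓_; +≤+)
import Data.Integer.Properties as ℤₚ
open import Data.Integer.Solver using (module +-*-Solver)
open import Data.List.Base as List using (List; []; _∷_; _++_; allFin; cartesianProduct; deduplicate; filter; length)
import Data.List.Membership.Propositional as List∈
open import Data.List.Membership.Propositional.Properties
  using (∈-allFin; ∈-cartesianProduct⁺; ∈-filter⁺; ∈-filter⁻; ∈-++⁺ˡ; ∈-++⁺ʳ; ∈-++⁻; ∈-map⁺; ∈-lookup)
open import Data.List.Relation.Unary.All as ListAll using ()
open import Data.List.Relation.Unary.AllPairs using (AllPairs; []; _∷_)
open import Data.List.Relation.Unary.Any as ListAny using (here; there)
open import Data.List.Relation.Unary.Any.Properties as ListAny using (lookup-index)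
open import Data.List.Relation.Unary.Unique.DecSetoid.Properties using (deduplicate-!)
open import Data.Nat.Base as ℕ using (ℕ; zero; suc; _∸_; _≤_; _<_; z≤n; s≤s)
import Data.Nat.Properties as ℕₚ
import Data.Nat.Solver as ℕ-Solver
open import Data.Product using (∃; _×_; _,_; proj₁; proj₂; uncurry)
open import Data.Sum.Base using (_⊎_; inj₁; inj₂; [_,_]′)
open import Data.Vec.Base as Vec using (Vec; []; _∷_; lookup; insertAt)
open import Data.Vec.Properties using (lookup-map; lookup∘tabulate)
open import Data.Vec.Relation.Unary.All using (All; []; _∷_)
open import Data.Vec.Relation.Unary.All.Properties using (lookup⁺)
open import Function.Base using (_∘_; id)
open import Level using (0ℓ)
open import Relation.Binary.Construct.Closure.Equivalence as EqClosure using (EqClosure)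
open import Relation.Binary.Core using (Rel; _⇒_)
open import Relation.Binary.Definitions using (Decidable)
open import Relation.Binary.PropositionalEquality
open import Relation.Nullary using (¬_; yes; no; contradiction)
open import Relation.Nullary.Decidable using (map′; _×-dec_)
open import Relation.Binary.Structures using (IsEquivalence)

private
  variable
    n k l : ℕ

-- A polynomial is its list of coefficients, constant term first.  Equality
-- is coefficientwise, so trailing zeros are irrelevant.
module Polynomial (R : RawRing 0ℓ 0ℓ) where
  open RawRing R

  Poly : Set
  Poly = List Carrier

  coeff : Poly → ℕ → Carrier
  coeff []      _       = 0#
  coeff (a ∷ p) zero    = a
  coeff (a ∷ p) (suc i) = coeff p i

  add : Poly → Poly → Poly
  add []      q       = q
  add (a ∷ p) []      = a ∷ p
  add (a ∷ p) (b ∷ q) = (a + b) ∷ add p q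

  mul : Poly → Poly → Poly
  mul []      q = []
  mul (a ∷ p) q = add (List.map (a *_) q) (0# ∷ mul p q)

  polynomialRing : RawRing 0ℓ 0ℓ
  polynomialRing = record
    { Carrier = Poly
    ; _≈_     = λ p q → ∀ i → coeff p i ≈ coeff q i
    ; _+_     = add
    ; _*_     = mul
    ; -_      = List.map -_
    ; 0#      = []
    ; 1#      = 1# ∷ []
    }

  constant : Carrier → Poly
  constant a = a ∷ []

  indeterminate : Poly
  indeterminate = 0# ∷ 1# ∷ []

module ℤ[x]   = Polynomial ℤ.+-*-rawRing
module ℤ[x,y] = Polynomial ℤ[x].polynomialRing

open RawRing ℤ[x,y].polynomialRing public
  renaming (Carrier to ℤ[x,y]) using (_≈_; _+_; _*_; -_; 0#; 1#)
open RawSemiringDefinitions (RawRing.rawSemiring ℤ[x,y].polynomialRing) public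
  using (_^_; sum)

x y : ℤ[x,y]
x = ℤ[x,y].constant ℤ[x].indeterminate
y = ℤ[x,y].indeterminate

sumSubsets : ∀ n → (Subset n → ℤ[x,y]) → ℤ[x,y]
sumSubsets zero    f = f []
sumSubsets (suc n) f = sumSubsets n (f ∘ (outside ∷_)) + sumSubsets n (f ∘ (inside ∷_))

eqv : (R : Rel (Fin n) 0ℓ) → IsEquivalence (EqClosure R)
eqv R = EqClosure.isEquivalence R

-- The equivalence relation generated by R has k classes, computed by merging
-- along a list of generating pairs.
record Classes {n} (R : Rel (Fin n) 0ℓ) (k : ℕ) : Set where
  field
    label     : Vec (Fin k) n
    rep       : Fin k → Fin n
    label-rep : ∀ i → lookup label (rep i) ≡ i
    sound     : ∀ u w → lookup label u ≡ lookup label w → EqClosure R u w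
    complete  : ∀ u w → R u w → lookup label u ≡ lookup label w

  complete* : ∀ u w → EqClosure R u w → lookup label u ≡ lookup label w
  complete* u w = EqClosure.gfold isEquivalence (lookup label) (complete _ _)

open Classes

classes-≤ : {R S : Rel (Fin n) 0ℓ} → R ⇒ EqClosure S → Classes R k → Classes S l → l ≤ k
classes-≤ {R = R} {S = S} R⇒S C D = injective⇒≤ {f = f} λ {i} {j} → inj i j
  where
  f = λ i → lookup (label C) (rep D i)
  inj : ∀ i j → f i ≡ f j → i ≡ j
  inj i j eq = begin
    i                                ≡⟨ label-rep D i ⟨
    lookup (label D) (rep D i)       ≡⟨ complete* D _ _ (EqClosure._⋆ R⇒S (sound C _ _ eq)) ⟩
    lookup (label D) (rep D j)       ≡⟨ label-rep D j ⟩
    j                                ∎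
    where open ≡-Reasoning

classes-≡ : {R S : Rel (Fin n) 0ℓ} → R ⇒ EqClosure S → S ⇒ EqClosure R → Classes R k → Classes S l → k ≡ l
classes-≡ R⇒S S⇒R C D = ℕₚ.≤-antisym (classes-≤ S⇒R D C) (classes-≤ R⇒S C D)

classes-map : {R S : Rel (Fin n) 0ℓ} → R ⇒ EqClosure S → S ⇒ EqClosure R → Classes R k → Classes S k
classes-map R⇒S S⇒R C = record
  { label     = label C
  ; rep       = rep C
  ; label-rep = label-rep C
  ; sound     = λ u w → EqClosure._⋆ R⇒S ∘ sound C u w
  ; complete  = λ u w → complete* C u w ∘ S⇒R
  }

Link : List (Fin n × Fin n) → Rel (Fin n) 0ℓ
Link ps u w = (u , w) List∈.∈ ps

discrete : Classes {n} (Link []) n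
discrete = record
  { label     = Vec.allFin _
  ; rep       = id
  ; label-rep = λ i → lookup∘tabulate id i
  ; sound     = λ u w eq → subst (EqClosure _ u)
      (trans (sym (lookup∘tabulate id u)) (trans eq (lookup∘tabulate id w)))
      (EqClosure.reflexive _)
  ; complete  = λ _ _ ()
  }

weaken : ∀ {ps : List (Fin n × Fin n)} {p} → EqClosure (Link ps) ⇒ EqClosure (Link (p ∷ ps))
weaken = EqClosure.map there

join : ∀ {ps} {a b : Fin n} (C : Classes (Link ps) k) →
       lookup (label C) a ≡ lookup (label C) b → Classes (Link ((a , b) ∷ ps)) k
join C eq = record
  { label     = label C
  ; rep       = rep C
  ; label-rep = label-rep C
  ; sound     = λ u w → weaken ∘ sound C u w
  ; complete  = λ { u w (here refl) → eq ; u w (there h) → complete C u w h }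
  }

collapse : {i j : Fin (suc k)} → i ≢ j → Fin (suc k) → Fin k
collapse {i = i} {j} i≢j z with j Fin.≟ z
... | yes _  = punchOut (i≢j ∘ sym)
... | no j≢z = punchOut j≢z

module _ {i j : Fin (suc k)} (i≢j : i ≢ j) where

  collapse-i : collapse i≢j i ≡ collapse i≢j j
  collapse-i with j Fin.≟ i | j Fin.≟ j
  ... | yes j≡i | _      = contradiction (sym j≡i) i≢j
  ... | no _    | no j≢j = contradiction refl j≢j
  ... | no _    | yes _  = punchOut-cong j refl

  collapse-punchIn : ∀ z → collapse i≢j (punchIn j z) ≡ z
  collapse-punchIn z with j Fin.≟ punchIn j z
  ... | yes eq = contradiction (sym eq) (punchInᵢ≢i j z)
  ... | no _   = trans (punchOut-cong j refl) (punchOut-punchIn j)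

  collapse-kernel : ∀ z w → collapse i≢j z ≡ collapse i≢j w →
                    z ≡ w ⊎ (z ≡ j × w ≡ i) ⊎ (z ≡ i × w ≡ j)
  collapse-kernel z w eq with j Fin.≟ z | j Fin.≟ w
  ... | yes p | yes q = inj₁ (trans (sym p) q)
  ... | yes p | no q  = inj₂ (inj₁ (sym p , sym (punchOut-injective _ q eq)))
  ... | no p  | yes q = inj₂ (inj₂ (punchOut-injective p _ eq , sym q))
  ... | no p  | no q  = inj₁ (punchOut-injective p q eq)

glue : ∀ {ps} {a b : Fin n} (C : Classes (Link ps) (suc k)) →
       lookup (label C) a ≢ lookup (label C) b → Classes (Link ((a , b) ∷ ps)) k
glue {ps = ps} {a} {b} C a≢b = record
  { label     = Vec.map c (label C)
  ; rep       = λ i → rep C (punchIn (lookup (label C) b) i)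
  ; label-rep = λ i → trans (lookup-map _ c (label C))
                     (trans (cong c (label-rep C _)) (collapse-punchIn a≢b i))
  ; sound     = λ u w eq → sound′ u w
                  (collapse-kernel a≢b _ _ (trans (sym (lc u)) (trans eq (lc w))))
  ; complete  = λ u w h → trans (lc u) (trans (complete′ u w h) (sym (lc w)))
  }
  where
  c = collapse a≢b
  lc = λ u → lookup-map u c (label C)
  R′ = Link ((a , b) ∷ ps)
  open IsEquivalence (eqv R′) renaming (trans to _⟫_; sym to inv) using ()

  a~b : EqClosure R′ a b
  a~b = EqClosure.return (here refl)

  sound′ : ∀ u w → (let L = lookup (label C)) →
           L u ≡ L w ⊎ (L u ≡ L b × L w ≡ L a) ⊎ (L u ≡ L a × L w ≡ L b) → EqClosure R′ u w
  sound′ u w (inj₁ e)              = weaken (sound C _ _ e)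
  sound′ u w (inj₂ (inj₁ (e , f))) =
    weaken (sound C _ _ e) ⟫ (inv a~b ⟫ weaken (sound C _ _ (sym f)))
  sound′ u w (inj₂ (inj₂ (e , f))) =
    weaken (sound C _ _ e) ⟫ (a~b ⟫ weaken (sound C _ _ (sym f)))

  complete′ : ∀ u w → R′ u w → c (lookup (label C) u) ≡ c (lookup (label C) w)
  complete′ u w (here refl) = collapse-i a≢b
  complete′ u w (there h)   = cong c (complete C u w h)

merge : ∀ {ps} (p : Fin n × Fin n) → ∃ (Classes (Link ps)) → ∃ (Classes (Link (p ∷ ps)))
merge (a , b) (k , C) with lookup (label C) a Fin.≟ lookup (label C) b
... | yes eq = k , join C eq
merge (a , b) (zero  , C) | no _ with () ← lookup (label C) a
merge (a , b) (suc k , C) | no neq = k , glue C neq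

linkClasses : (ps : List (Fin n × Fin n)) → ∃ (Classes (Link ps))
linkClasses []       = _ , discrete
linkClasses (p ∷ ps) = merge p (linkClasses ps)

-- The coarser relation loses no more classes than the finer one when both are
-- enlarged by the same pair.
link-step : ∀ {ps qs} {p : Fin n × Fin n} {k′ l′} → Link ps ⇒ EqClosure (Link qs) →
            Classes (Link ps) k → Classes (Link qs) l →
            Classes (Link (p ∷ ps)) k′ → Classes (Link (p ∷ qs)) l′ → k′ ℕ.+ l ≤ k ℕ.+ l′
link-step {k = k} {l = l} {p = a , b} inc C D C′ D′
  with lookup (label C) a Fin.≟ lookup (label C) b | lookup (label D) a Fin.≟ lookup (label D) b
... | yes e | yes f
  rewrite classes-≡ EqClosure.return EqClosure.return C′ (join C e)
        | classes-≡ EqClosure.return EqClosure.return D′ (join D f) = ℕₚ.≤-refl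
... | yes e | no f = contradiction (complete* D _ _ (EqClosure._⋆ inc (sound C _ _ e))) f
link-step {k = zero} {p = a , b} inc C D C′ D′ | no _ | _ with () ← lookup (label C) a
link-step {k = suc k} {p = a , b} inc C D C′ D′ | no e | yes f
  rewrite classes-≡ EqClosure.return EqClosure.return C′ (glue C e)
        | classes-≡ EqClosure.return EqClosure.return D′ (join D f) = ℕₚ.n≤1+n _
link-step {l = zero} {p = a , b} inc C D C′ D′ | _ | no _ with () ← lookup (label D) a
link-step {k = suc k} {l = suc l} inc C D C′ D′ | no e | no f
  rewrite classes-≡ EqClosure.return EqClosure.return C′ (glue C e)
        | classes-≡ EqClosure.return EqClosure.return D′ (glue D f)
        | ℕₚ.+-suc k l = ℕₚ.≤-refl

++-mono : ∀ {ps qs} (bs : List (Fin n × Fin n)) → Link ps ⇒ EqClosure (Link qs) →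
          Link (bs ++ ps) ⇒ EqClosure (Link (bs ++ qs))
++-mono bs inc h with ∈-++⁻ bs h
... | inj₁ h∈bs = EqClosure.return (∈-++⁺ˡ h∈bs)
... | inj₂ h∈ps = EqClosure.map (∈-++⁺ʳ bs) (inc h∈ps)

supermodular : ∀ {ps qs} (bs : List (Fin n × Fin n)) {k′ l′} → Link ps ⇒ EqClosure (Link qs) →
               Classes (Link ps) k → Classes (Link qs) l →
               Classes (Link (bs ++ ps)) k′ → Classes (Link (bs ++ qs)) l′ → k′ ℕ.+ l ≤ k ℕ.+ l′
supermodular [] inc C D C′ D′
  rewrite classes-≡ EqClosure.return EqClosure.return C′ C
        | classes-≡ EqClosure.return EqClosure.return D′ D = ℕₚ.≤-refl
supermodular {k = k} {l} {ps} {qs} (p ∷ bs) {k′} {l′} inc C D C′ D′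
  with linkClasses (bs ++ ps) | linkClasses (bs ++ qs)
... | k₁ , C₁ | l₁ , D₁ = ℕₚ.+-cancelˡ-≤ (k₁ ℕ.+ l₁) _ _ (begin
    (k₁ ℕ.+ l₁) ℕ.+ (k′ ℕ.+ l)  ≡⟨ solve 4 (λ a b c d → (a :+ b) :+ (c :+ d) := (a :+ d) :+ (c :+ b)) refl k₁ l₁ k′ l ⟩
    (k₁ ℕ.+ l) ℕ.+ (k′ ℕ.+ l₁)  ≤⟨ ℕₚ.+-mono-≤ (supermodular bs inc C D C₁ D₁)
                                     (link-step (++-mono bs inc) C₁ D₁ C′ D′) ⟩
    (k ℕ.+ l₁) ℕ.+ (k₁ ℕ.+ l′)  ≡⟨ solve 4 (λ a b c d → (a :+ b) :+ (c :+ d) := (c :+ b) :+ (a :+ d)) refl k l₁ k₁ l′ ⟩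
    (k₁ ℕ.+ l₁) ℕ.+ (k ℕ.+ l′)  ∎)
  where
  open ℕₚ.≤-Reasoning
  open ℕ-Solver.+-*-Solver

links : {R : Rel (Fin n) 0ℓ} → Decidable R → List (Fin n × Fin n)
links R? = filter (uncurry R?) (cartesianProduct (allFin _) (allFin _))

module _ {R : Rel (Fin n) 0ℓ} (R? : Decidable R) where

  links⁺ : R ⇒ Link (links R?)
  links⁺ = ∈-filter⁺ (uncurry R?) (∈-cartesianProduct⁺ (∈-allFin _) (∈-allFin _))

  links⁻ : Link (links R?) ⇒ R
  links⁻ h = proj₂ (∈-filter⁻ (uncurry R?) {xs = cartesianProduct (allFin _) (allFin _)} h)

  classes : ∃ (Classes R)
  classes = let k , C = linkClasses (links R?) in
    k , classes-map (EqClosure.return ∘ links⁻) (EqClosure.return ∘ links⁺) C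

module _ {X : Set} {_~_ : Rel X 0ℓ} (eq : IsEquivalence _~_) (_~?_ : Decidable _~_) where
  open IsEquivalence eq renaming (refl to ~-refl; sym to ~-sym; trans to ~-trans)

  private
    D = deduplicate _~?_

  dedup-injective : ∀ xs i j → List.lookup (D xs) i ~ List.lookup (D xs) j → i ≡ j
  dedup-injective xs = go (deduplicate-! (record { isDecEquivalence = record
    { isEquivalence = eq ; _≟_ = _~?_ } }) xs)
    where
    go : ∀ {ys} → AllPairs (λ a b → ¬ (a ~ b)) ys →
         ∀ i j → List.lookup ys i ~ List.lookup ys j → i ≡ j
    go (_ ∷ _)  zero    zero    _ = refl
    go (a ∷ _)  zero    (suc j) h = contradiction h (ListAll.lookup a (∈-lookup j))
    go (a ∷ _)  (suc i) zero    h = contradiction (~-sym h) (ListAll.lookup a (∈-lookup i))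
    go (_ ∷ as) (suc i) (suc j) h = cong suc (go as i j h)

  dedup-covers : ∀ {xs} z → z List∈.∈ xs → ∃ λ i → z ~ List.lookup (D xs) i
  dedup-covers {xs} z z∈xs = ListAny.index any , lookup-index any
    where
    any : ListAny.Any (z ~_) (D xs)
    any = ListAny.deduplicate⁺ _~?_ (λ b~a z~a → ~-trans z~a (~-sym b~a))
            (ListAny.map (λ { refl → ~-refl }) z∈xs)

  dedup-classes : ∀ {R : Rel (Fin n) 0ℓ} xs (f : X → Fin n) (g : Fin n → X) →
                  (∀ u → g u List∈.∈ xs) → (∀ u → f (g u) ≡ u) →
                  (∀ {a b} → a ~ b → EqClosure R (f a) (f b)) →
                  (∀ {a b} → EqClosure R (f a) (f b) → a ~ b) →
                  Classes R k → length (D xs) ≡ k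
  dedup-classes {R = R} xs f g g∈ fg f-mono f-reflect C = ℕₚ.≤-antisym
    (injective⇒≤ {f = λ i → lookup (label C) (f (List.lookup (D xs) i))}
      λ {i} {j} h → dedup-injective xs i j (f-reflect (sound C _ _ h)))
    (injective⇒≤ {f = λ i → proj₁ (cover i)} λ {i} {j} h →
      trans (sym (label-rep C i)) (trans (complete* C _ _ (same i j h)) (label-rep C j)))
    where
    cover : ∀ i → ∃ λ c → g (rep C i) ~ List.lookup (D xs) c
    cover i = dedup-covers (g (rep C i)) (g∈ (rep C i))

    same : ∀ i j → proj₁ (cover i) ≡ proj₁ (cover j) → EqClosure R (rep C i) (rep C j)
    same i j h = subst₂ (EqClosure R) (fg _) (fg _) (f-mono
      (~-trans (proj₂ (cover i)) (~-sym
        (subst (λ c → g (rep C j) ~ List.lookup (D xs) c) (sym h) (proj₂ (cover j))))))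

-- A multiset of elements of Fin n is given by its multiplicities.
Multiset : ℕ → Set
Multiset n = Vec ℕ n

size : Multiset n → ℕ
size = Vec.sum

-- The hyperedges are indexed by Fin m, so parallel ones are distinct.
record Hypergraph : Set where
  field
    v        : ℕ
    m        : ℕ
    edges    : Vec (Multiset v) m
    degree>1 : All (λ e → 1 < size e) edges

  multiplicity : Fin v → Fin m → ℕ
  multiplicity u e = lookup (lookup edges e) u

  totalDegree : ℕ
  totalDegree = Vec.sum (Vec.map size edges)

  Node : Set
  Node = Fin v ⊎ Fin m

  nodes : List Node
  nodes = List.map inj₁ (allFin v) ++ List.map inj₂ (allFin m)

  -- The edge multiplicities of the bipartite incidence graph do not affect
  -- its components, so only adjacency is recorded.
  data Adjacent : Rel Node 0ℓ where
    incident : ∀ {u e} → 0 < multiplicity u e → Adjacent (inj₁ u) (inj₂ e)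

  Connected : Rel Node 0ℓ
  Connected = EqClosure Adjacent

  Linked : Rel (Fin v) 0ℓ
  Linked u w = ∃ λ e → 0 < multiplicity u e × 0 < multiplicity w e

  linked? : Decidable Linked
  linked? u w = any? λ e → (0 ℕₚ.<? multiplicity u e) ×-dec (0 ℕₚ.<? multiplicity w e)

  anchor : ∀ e → ∃ λ u → 0 < multiplicity u e
  anchor e = positive (lookup edges e) (ℕₚ.<-trans ℕₚ.0<1+n (lookup⁺ degree>1 e))
    where
    positive : ∀ {n} (μ : Multiset n) → 0 < size μ → ∃ λ u → 0 < lookup μ u
    positive (zero  ∷ μ) 0<s = let u , h = positive μ 0<s in suc u , h
    positive (suc _ ∷ μ) _   = zero , s≤s z≤n

  vertexOf : Node → Fin v
  vertexOf (inj₁ u) = u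
  vertexOf (inj₂ e) = proj₁ (anchor e)

  Connected⇒Linked : ∀ {a b} → Connected a b → EqClosure Linked (vertexOf a) (vertexOf b)
  Connected⇒Linked = EqClosure.gfold (eqv Linked) vertexOf
    λ { (incident {e = e} h) → EqClosure.return (e , h , proj₂ (anchor e)) }

  Linked⇒Connected : ∀ {a b} → EqClosure Linked (vertexOf a) (vertexOf b) → Connected a b
  Linked⇒Connected {a} {b} h =
    to-vertex a ⟫ (EqClosure.gfold isEq inj₁
      (λ { (e , p , q) → EqClosure.return (incident p) ⟫ inv (EqClosure.return (incident q)) }) h
      ⟫ inv (to-vertex b))
    where
    isEq = EqClosure.isEquivalence Adjacent
    open IsEquivalence isEq renaming (trans to _⟫_; sym to inv; refl to done) using ()
    to-vertex : ∀ a → Connected a (inj₁ (vertexOf a))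
    to-vertex (inj₁ u) = done
    to-vertex (inj₂ e) = inv (EqClosure.return (incident (proj₂ (anchor e))))

  connected? : Decidable Connected
  connected? = decide (proj₂ (classes linked?))
    where
    decide : ∀ {k} → Classes Linked k → Decidable Connected
    decide C a b = map′ (Linked⇒Connected ∘ sound C _ _) (complete* C _ _ ∘ Connected⇒Linked)
      (lookup (label C) (vertexOf a) Fin.≟ lookup (label C) (vertexOf b))

  κ : ℕ
  κ = length (deduplicate connected? nodes)

  κ-classes : Classes Linked k → κ ≡ k
  κ-classes = dedup-classes (EqClosure.isEquivalence Adjacent) connected? nodes
    vertexOf inj₁ (λ u → ∈-++⁺ˡ (∈-map⁺ inj₁ (∈-allFin u))) (λ _ → refl)
    Connected⇒Linked Linked⇒Connected

open Hypergraph

select : ∀ {X : Set} → Vec X n → (A : Subset n) → Vec X ∣ A ∣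
select []       []            = []
select (e ∷ es) (inside  ∷ A) = e ∷ select es A
select (e ∷ es) (outside ∷ A) = select es A

select-All : ∀ {X : Set} {P : X → Set} {es : Vec X n} → All P es → ∀ A → All P (select es A)
select-All []       []            = []
select-All (p ∷ ps) (inside  ∷ A) = p ∷ select-All ps A
select-All (p ∷ ps) (outside ∷ A) = select-All ps A

-- The hypergraph (V , A).
_↾_ : (H : Hypergraph) → Subset (m H) → Hypergraph
H ↾ A = record
  { v        = v H
  ; m        = ∣ A ∣
  ; edges    = select (edges H) A
  ; degree>1 = select-All (degree>1 H) A
  }

FourUniform : Hypergraph → Set
FourUniform H = ∀ e → size (lookup (edges H) e) ≡ 4

-- Both exponents are nonnegative, as is d(A) - |A|: deleting hyperedges does
-- not decrease κ, and each e merges at most d(e) components into one.  So no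
-- subtraction below truncates.
T-HG : Hypergraph → ℤ[x,y]
T-HG H = sumSubsets (m H) λ A →
    (x + - 1#) ^ (κ (H ↾ A) ∸ κ H)
  * (y + - 1#) ^ (((totalDegree (H ↾ A) ∸ ∣ A ∣) ℕ.+ κ (H ↾ A)) ∸ v H)

record Polymatroid (n : ℕ) : Set where
  field
    rank       : Subset n → ℤ
    normalized : rank ⊥ ≡ 0ℤ
    increasing : ∀ {A B} → A ⊆ B → rank A ℤ.≤ rank B
    submodular : ∀ A B → rank (A ∪ B) ℤ.+ rank (A ∩ B) ℤ.≤ rank A ℤ.+ rank B

  α β : Fin n → ℤ
  α e = rank ⊤ ℤ.- rank (⊤ ∖ e)
  β e = rank ⁅ e ⁆

  α≤β : ∀ e → α e ℤ.≤ β e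
  α≤β e = begin
    rank ⊤ ℤ.- rank (⊤ ∖ e)                       ≤⟨ ℤₚ.+-monoˡ-≤ (ℤ.- rank (⊤ ∖ e)) bound ⟩
    (rank (⊤ ∖ e) ℤ.+ rank ⁅ e ⁆) ℤ.- rank (⊤ ∖ e) ≡⟨ solve 2 (λ a b → (a :+ b) :- a := b) refl (rank (⊤ ∖ e)) (rank ⁅ e ⁆) ⟩
    rank ⁅ e ⁆                                    ∎
    where
    open ℤₚ.≤-Reasoning
    open +-*-Solver
    cover : ⊤ ⊆ (⊤ ∖ e) ∪ ⁅ e ⁆
    cover {u} u∈⊤ with u Fin.≟ e
    ... | yes refl = x∈p∪q⁺ (inj₂ (x∈⁅x⁆ e))
    ... | no u≢e   = x∈p∪q⁺ (inj₁ (x∈p∧x≢y⇒x∈p-y u∈⊤ u≢e))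
    bound : rank ⊤ ℤ.≤ rank (⊤ ∖ e) ℤ.+ rank ⁅ e ⁆
    bound = begin
      rank ⊤                                                     ≤⟨ increasing cover ⟩
      rank ((⊤ ∖ e) ∪ ⁅ e ⁆)                                     ≡⟨ ℤₚ.+-identityʳ _ ⟨
      rank ((⊤ ∖ e) ∪ ⁅ e ⁆) ℤ.+ 0ℤ                              ≡⟨ cong (λ z → rank ((⊤ ∖ e) ∪ ⁅ e ⁆) ℤ.+ z) normalized ⟨
      rank ((⊤ ∖ e) ∪ ⁅ e ⁆) ℤ.+ rank ⊥                          ≤⟨ ℤₚ.+-monoʳ-≤ (rank ((⊤ ∖ e) ∪ ⁅ e ⁆)) (increasing ⊥⊆) ⟩
      rank ((⊤ ∖ e) ∪ ⁅ e ⁆) ℤ.+ rank ((⊤ ∖ e) ∩ ⁅ e ⁆)          ≤⟨ submodular (⊤ ∖ e) ⁅ e ⁆ ⟩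
      rank (⊤ ∖ e) ℤ.+ rank ⁅ e ⁆                                ∎

open Polymatroid

insertAt-⊥-outside : (e : Fin (suc n)) → insertAt ⊥ e outside ≡ ⊥
insertAt-⊥-outside zero = refl
insertAt-⊥-outside {suc n} (suc e) = cong (outside ∷_) (insertAt-⊥-outside e)

insertAt-⊥-inside : (e : Fin (suc n)) → insertAt ⊥ e inside ≡ ⁅ e ⁆
insertAt-⊥-inside zero = refl
insertAt-⊥-inside {suc n} (suc e) = cong (outside ∷_) (insertAt-⊥-inside e)

insertAt-zipWith : ∀ (f : Side → Side → Side) (A B : Subset n) e s t →
  insertAt (Vec.zipWith f A B) e (f s t) ≡ Vec.zipWith f (insertAt A e s) (insertAt B e t)
insertAt-zipWith f A       B       zero    s t = refl
insertAt-zipWith f (_ ∷ A) (_ ∷ B) (suc e) s t = cong (_ ∷_) (insertAt-zipWith f A B e s t)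

insertAt-⊆ : ∀ {A B : Subset n} e s → A ⊆ B → insertAt A e s ⊆ insertAt B e s
insertAt-⊆ zero s A⊆B Vec.here      = Vec.here
insertAt-⊆ zero s A⊆B (Vec.there h) = Vec.there (A⊆B h)
insertAt-⊆ {A = a ∷ A} {b ∷ B} (suc e) s A⊆B Vec.here with Vec.here ← A⊆B Vec.here = Vec.here
insertAt-⊆ {A = a ∷ A} {b ∷ B} (suc e) s A⊆B (Vec.there h) =
  Vec.there (insertAt-⊆ e s (drop-∷-⊆ A⊆B) h)

-- The polymatroid P_{e,j}: insertAt A e outside and insertAt A e inside are
-- A and A ∪ {e} as subsets of the groundset of P.
slice : (P : Polymatroid (suc n)) (e : Fin (suc n)) (j : ℤ) → j ℤ.≤ β P e → Polymatroid n
slice {n} P e j j≤β = record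
  { rank       = λ A → rank P (insertAt A e outside) ⊓ (rank P (insertAt A e inside) ℤ.- j)
  ; normalized = norm
  ; increasing = λ A⊆B → ℤₚ.⊓-mono-≤ (increasing P (insertAt-⊆ e outside A⊆B))
                   (ℤₚ.+-monoˡ-≤ (ℤ.- j) (increasing P (insertAt-⊆ e inside A⊆B)))
  ; submodular = sub
  }
  where
  open ℤₚ.≤-Reasoning

  norm : rank P (insertAt ⊥ e outside) ⊓ (rank P (insertAt ⊥ e inside) ℤ.- j) ≡ 0ℤ
  norm rewrite insertAt-⊥-outside e | insertAt-⊥-inside e | normalized P =
    ℤₚ.i≤j⇒i⊓j≡i (ℤₚ.i≤j⇒0≤j-i j≤β)

  shift : Side → ℤ
  shift outside = 0ℤ
  shift inside  = j

  h : Side → Subset n → ℤ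
  h s A = rank P (insertAt A e s) ℤ.- shift s

  min : Subset n → ℤ
  min A = h outside A ⊓ h inside A

  min≤h : ∀ s A → min A ℤ.≤ h s A
  min≤h outside A = ℤₚ.i⊓j≤i _ _
  min≤h inside  A = ℤₚ.i⊓j≤j (h outside A) _

  shift-modular : ∀ s t → shift (s ∨ t) ℤ.+ shift (s ∧ t) ≡ shift s ℤ.+ shift t
  shift-modular outside t = ℤₚ.+-comm (shift t) 0ℤ
  shift-modular inside  t = refl

  regroup : ∀ a b c d → (a ℤ.- b) ℤ.+ (c ℤ.- d) ≡ (a ℤ.+ c) ℤ.- (b ℤ.+ d)
  regroup = solve 4 (λ a b c d → (a :- b) :+ (c :- d) := (a :+ c) :- (b :+ d)) refl
    where open +-*-Solver

  h-submodular : ∀ s t A B → h (s ∨ t) (A ∪ B) ℤ.+ h (s ∧ t) (A ∩ B) ℤ.≤ h s A ℤ.+ h t B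
  h-submodular s t A B = begin
    h (s ∨ t) (A ∪ B) ℤ.+ h (s ∧ t) (A ∩ B)
      ≡⟨ regroup (r (A ∪ B) (s ∨ t)) (shift (s ∨ t)) (r (A ∩ B) (s ∧ t)) (shift (s ∧ t)) ⟩
    (r (A ∪ B) (s ∨ t) ℤ.+ r (A ∩ B) (s ∧ t)) ℤ.- (shift (s ∨ t) ℤ.+ shift (s ∧ t))
      ≡⟨ cong₂ ℤ._-_ (cong₂ ℤ._+_ (cong (rank P) (insertAt-zipWith _∨_ A B e s t))
                                 (cong (rank P) (insertAt-zipWith _∧_ A B e s t)))
                    (shift-modular s t) ⟩
    (rank P (A′ ∪ B′) ℤ.+ rank P (A′ ∩ B′)) ℤ.- (shift s ℤ.+ shift t)
      ≤⟨ ℤₚ.+-monoˡ-≤ (ℤ.- (shift s ℤ.+ shift t)) (submodular P A′ B′) ⟩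
    (r A s ℤ.+ r B t) ℤ.- (shift s ℤ.+ shift t)
      ≡⟨ regroup (r A s) (shift s) (r B t) (shift t) ⟨
    h s A ℤ.+ h t B ∎
    where
    r : Subset n → Side → ℤ
    r A s = rank P (insertAt A e s)
    A′ = insertAt A e s
    B′ = insertAt B e t

  attained : ∀ A → ∃ λ s → min A ≡ h s A
  attained A with ℤₚ.⊓-sel (h outside A) (h inside A)
  ... | inj₁ eq = outside , eq
  ... | inj₂ eq = inside , eq

  min-submodular : ∀ A B → min (A ∪ B) ℤ.+ min (A ∩ B) ℤ.≤ min A ℤ.+ min B
  min-submodular A B with attained A | attained B
  ... | s , p | t , q = begin
    min (A ∪ B) ℤ.+ min (A ∩ B)              ≤⟨ ℤₚ.+-mono-≤ (min≤h (s ∨ t) (A ∪ B)) (min≤h (s ∧ t) (A ∩ B)) ⟩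
    h (s ∨ t) (A ∪ B) ℤ.+ h (s ∧ t) (A ∩ B)  ≤⟨ h-submodular s t A B ⟩
    h s A ℤ.+ h t B                          ≡⟨ cong₂ ℤ._+_ p q ⟨
    min A ℤ.+ min B                          ∎

  min≡ : ∀ A → min A ≡ rank P (insertAt A e outside) ⊓ (rank P (insertAt A e inside) ℤ.- j)
  min≡ A = cong (_⊓ h inside A) (ℤₚ.+-identityʳ _)

  sub : ∀ A B → _
  sub A B = subst₂ ℤ._≤_ (cong₂ ℤ._+_ (min≡ (A ∪ B)) (min≡ (A ∩ B)))
                        (cong₂ ℤ._+_ (min≡ A) (min≡ B)) (min-submodular A B)

between : ∀ {a b i} → a ℤ.≤ b → i ≤ ℤ.∣ b ℤ.- a ∣ → a ℤ.+ + i ℤ.≤ b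
between {a} {b} {i} a≤b i≤ = begin
  a ℤ.+ + i                  ≤⟨ ℤₚ.+-monoʳ-≤ a (+≤+ i≤) ⟩
  a ℤ.+ + ℤ.∣ b ℤ.- a ∣      ≡⟨ cong (λ z → a ℤ.+ z) (ℤₚ.0≤i⇒+∣i∣≡i (ℤₚ.i≤j⇒0≤j-i a≤b)) ⟩
  a ℤ.+ (b ℤ.- a)            ≡⟨ solve 2 (λ a b → a :+ (b :- a) := b) refl a b ⟩
  b                          ∎
  where
  open ℤₚ.≤-Reasoning
  open +-*-Solver

_\\_ _//_ : Polymatroid (suc n) → Fin (suc n) → Polymatroid n
P \\ e = slice P e (α P e) (α≤β P e)
P // e = slice P e (β P e) ℤₚ.≤-refl

-- The number of integers j with α_e < j < β_e.
gap : Polymatroid (suc n) → Fin (suc n) → ℕ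
gap P e = ℤ.∣ β P e ℤ.- α P e ∣ ∸ 1

innerSlice : (P : Polymatroid (suc n)) (e : Fin (suc n)) → Fin (gap P e) → Polymatroid n
innerSlice P e i = slice P e (α P e ℤ.+ + suc (toℕ i))
  (between (α≤β P e) (lemma _ (toℕ<n i)))
  where
  lemma : ∀ g {i} → i < g ∸ 1 → i < g
  lemma (suc g) = ℕₚ.m≤n⇒m≤1+n

-- The result does not depend on the element e on which each step branches;
-- here e is always the first element of the groundset.
𝒯 : Polymatroid n → ℤ[x,y]
𝒯 {zero}  P = 1#
𝒯 {suc n} P with α P zero ℤₚ.≟ β P zero
... | yes _ = (x + y + - 1#) * 𝒯 (P \\ zero)
... | no  _ = x * 𝒯 (P \\ zero) + y * 𝒯 (P // zero) + sum (λ i → 𝒯 (innerSlice P zero i))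

module _ (H : Hypergraph) where

  LinkedIn : Subset (m H) → Rel (Fin (v H)) 0ℓ
  LinkedIn A u w = ∃ λ e → e ∈ A × 0 < multiplicity H u e × 0 < multiplicity H w e

  private
    select⁻ : ∀ {X : Set} (es : Vec X n) A i → ∃ λ e → e ∈ A × lookup (select es A) i ≡ lookup es e
    select⁻ (_ ∷ es) (inside  ∷ A) zero    = zero , Vec.here , refl
    select⁻ (_ ∷ es) (inside  ∷ A) (suc i) = let e , e∈A , eq = select⁻ es A i in suc e , Vec.there e∈A , eq
    select⁻ (_ ∷ es) (outside ∷ A) i       = let e , e∈A , eq = select⁻ es A i in suc e , Vec.there e∈A , eq

    select⁺ : ∀ {X : Set} (es : Vec X n) {A e} → e ∈ A → ∃ λ i → lookup (select es A) i ≡ lookup es e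
    select⁺ (_ ∷ es) {inside  ∷ A} Vec.here        = zero , refl
    select⁺ (_ ∷ es) {inside  ∷ A} (Vec.there e∈A) = let i , eq = select⁺ es e∈A in suc i , eq
    select⁺ (_ ∷ es) {outside ∷ A} (Vec.there e∈A) = select⁺ es e∈A

  Linked⇒LinkedIn : ∀ A → Linked (H ↾ A) ⇒ LinkedIn A
  Linked⇒LinkedIn A {u} {w} (i , p , q) = let e , e∈A , eq = select⁻ (edges H) A i in
    e , e∈A , subst (λ μ → 0 < lookup μ u) eq p , subst (λ μ → 0 < lookup μ w) eq q

  LinkedIn⇒Linked : ∀ A → LinkedIn A ⇒ Linked (H ↾ A)
  LinkedIn⇒Linked A {u} {w} (e , e∈A , p , q) = let i , eq = select⁺ (edges H) e∈A in
    i , subst (λ μ → 0 < lookup μ u) (sym eq) p , subst (λ μ → 0 < lookup μ w) (sym eq) q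

  linksIn : Subset (m H) → List (Fin (v H) × Fin (v H))
  linksIn A = links (linked? (H ↾ A))

  linksIn⁺ : ∀ A → LinkedIn A ⇒ Link (linksIn A)
  linksIn⁺ A = links⁺ (linked? (H ↾ A)) ∘ LinkedIn⇒Linked A

  linksIn⁻ : ∀ A → Link (linksIn A) ⇒ LinkedIn A
  linksIn⁻ A = Linked⇒LinkedIn A ∘ links⁻ (linked? (H ↾ A))

  private
    κ-classesIn : ∀ A → Classes (LinkedIn A) (κ (H ↾ A))
    κ-classesIn A with classes (linked? (H ↾ A))
    ... | k , C rewrite κ-classes (H ↾ A) C = classes-map
      (EqClosure.return ∘ Linked⇒LinkedIn A) (EqClosure.return ∘ LinkedIn⇒Linked A) C

    LinkedIn-mono : ∀ {A B} → A ⊆ B → LinkedIn A ⇒ LinkedIn B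
    LinkedIn-mono A⊆B (e , e∈A , h) = e , A⊆B e∈A , h

  κ-⊥ : κ (H ↾ ⊥) ≡ v H
  κ-⊥ = classes-≡ (λ { (_ , e∈⊥ , _) → ⊥-elim (∉⊥ e∈⊥) }) (λ ()) (κ-classesIn ⊥) discrete

  κ-antitone : ∀ {A B} → A ⊆ B → κ (H ↾ B) ≤ κ (H ↾ A)
  κ-antitone {A} {B} A⊆B =
    classes-≤ (EqClosure.return ∘ LinkedIn-mono A⊆B) (κ-classesIn A) (κ-classesIn B)

  κ-supermodular : ∀ A B → κ (H ↾ A) ℕ.+ κ (H ↾ B) ≤ κ (H ↾ (A ∪ B)) ℕ.+ κ (H ↾ (A ∩ B))
  κ-supermodular A B = subst₂ _≤_ (ℕₚ.+-comm (κ (H ↾ B)) _) (ℕₚ.+-comm (κ (H ↾ (A ∩ B))) _)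
    (supermodular (linksIn B)
      (EqClosure.return ∘ linksIn⁺ A ∘ LinkedIn-mono (proj₁ ∘ x∈p∩q⁻ A B) ∘ linksIn⁻ (A ∩ B))
      (by-links (A ∩ B)) (by-links A)
      (classes-map (EqClosure.return ∘ ∈-++⁺ˡ ∘ linksIn⁺ B)
        (EqClosure.return ∘ [ linksIn⁻ B , LinkedIn-mono (proj₂ ∘ x∈p∩q⁻ A B) ∘ linksIn⁻ (A ∩ B) ]′
          ∘ ∈-++⁻ (linksIn B))
        (κ-classesIn B))
      (classes-map (EqClosure.return ∘ split)
        (EqClosure.return ∘ [ LinkedIn-mono (x∈p∪q⁺ ∘ inj₂) ∘ linksIn⁻ B
                            , LinkedIn-mono (x∈p∪q⁺ ∘ inj₁) ∘ linksIn⁻ A ]′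
          ∘ ∈-++⁻ (linksIn B))
        (κ-classesIn (A ∪ B))))
    where
    by-links : ∀ A → Classes (Link (linksIn A)) (κ (H ↾ A))
    by-links A = classes-map (EqClosure.return ∘ linksIn⁺ A) (EqClosure.return ∘ linksIn⁻ A) (κ-classesIn A)

    split : LinkedIn (A ∪ B) ⇒ Link (linksIn B ++ linksIn A)
    split (e , e∈ , h) with x∈p∪q⁻ A B e∈
    ... | inj₁ e∈A = ∈-++⁺ʳ (linksIn B) (linksIn⁺ A (e , e∈A , h))
    ... | inj₂ e∈B = ∈-++⁺ˡ (linksIn⁺ B (e , e∈B , h))

  polymatroid : Polymatroid (m H)
  polymatroid = record
    { rank       = λ A → + v H ℤ.- + κ (H ↾ A)
    ; normalized = trans (cong (λ c → + v H ℤ.- + c) κ-⊥) (ℤₚ.+-inverseʳ (+ v H))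
    ; increasing = λ A⊆B → ℤₚ.+-monoʳ-≤ (+ v H) (ℤₚ.neg-mono-≤ (+≤+ (κ-antitone A⊆B)))
    ; submodular = λ A B → subst₂ ℤ._≤_ (regroup (v H) (κ (H ↾ (A ∪ B))) (κ (H ↾ (A ∩ B))))
                                       (regroup (v H) (κ (H ↾ A)) (κ (H ↾ B)))
        (ℤₚ.+-monoʳ-≤ (+ v H ℤ.+ + v H) (ℤₚ.neg-mono-≤ (+≤+ (κ-supermodular A B))))
    }
    where
    open +-*-Solver
    regroup : ∀ a b c → (+ a ℤ.+ + a) ℤ.- + (b ℕ.+ c) ≡ (+ a ℤ.- + b) ℤ.+ (+ a ℤ.- + c)
    regroup a b c = trans (cong (λ z → (+ a ℤ.+ + a) ℤ.- z) (ℤₚ.pos-+ b c))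
      (solve 3 (λ a b c → (a :+ a) :- (b :+ c) := (a :- b) :+ (a :- c)) refl (+ a) (+ b) (+ c))

record SameParameters (H H′ : Hypergraph) : Set where
  field
    same-v           : v H ≡ v H′
    same-κ           : κ H ≡ κ H′
    same-m           : m H ≡ m H′
    same-totalDegree : totalDegree H ≡ totalDegree H′

{-# OPTIONS --safe #-}
-- T-HG of a 4-uniform hypergraph only counts the sets of hyperedges of each
-- cardinality and rank.  H₁ and H₂ agree in these counts: singletons have ranks
-- 1, 2, 2 and pairs 2, 3, 3.  But the pair of rank 2 has singletons of ranks 1
-- and 2 in H₁, whereas it is a pair of parallel hyperedges in H₂, and the
-- constant coefficients of 𝒯 are 0 and 1.
-- Conversely 𝒯 does not see the ranks in a sum of one-element polymatroids,
-- as each of them contributes the factor x + y − 1.  In H₃ and H₄, two such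
-- summands have ranks 0, 2 and 1, 1 respectively.
module Submission where

open import Defs
import Data.Fin.Properties as Fin
open import Data.Nat.Properties using (_<?_; _≟_)
open import Data.Product using (∃₂; _×_; _,_)
open import Data.Unit.Base using (tt)
open import Data.Vec.Base using (Vec; []; _∷_; lookup)
open import Data.Vec.Relation.Unary.All using (all?)
open import Function.Base using (case_of_)
open import Relation.Binary.PropositionalEquality using (_≡_; refl)
open import Relation.Nullary using (¬_; Dec)
open import Relation.Nullary.Decidable using (True; toWitness)

open Hypergraph using (edges)

hypergraph : ∀ {v m} (es : Vec (Multiset v) m) {_ : True (all? (λ e → 1 <? size e) es)} → Hypergraph
hypergraph es {ok} = record { edges = es ; degree>1 = toWitness ok }

-- Vertex `zero` lies on every hyperedge and pads its size to 4, so the rank of a nonempty set of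
-- hyperedges is the number of vertices it covers minus 1.
H₁ H₂ H₃ H₄ : Hypergraph
H₁ = hypergraph ((3 ∷ 1 ∷ 0 ∷ 0 ∷ []) ∷ (2 ∷ 1 ∷ 1 ∷ 0 ∷ []) ∷ (2 ∷ 0 ∷ 1 ∷ 1 ∷ []) ∷ [])
H₂ = hypergraph ((3 ∷ 1 ∷ 0 ∷ 0 ∷ []) ∷ (2 ∷ 0 ∷ 1 ∷ 1 ∷ []) ∷ (2 ∷ 0 ∷ 1 ∷ 1 ∷ []) ∷ [])
H₃ = hypergraph ((4 ∷ 0 ∷ 0 ∷ []) ∷ (2 ∷ 1 ∷ 1 ∷ []) ∷ [])
H₄ = hypergraph ((3 ∷ 1 ∷ 0 ∷ []) ∷ (3 ∷ 0 ∷ 1 ∷ []) ∷ [])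

fourUniform? : ∀ H → Dec (FourUniform H)
fourUniform? H = Fin.all? λ e → size (lookup (edges H) e) ≟ 4

-- Reduces `≈` to a single comparison of evaluated coefficient lists.
reflexive : (p q : ℤ[x,y]) → p ≡ q → p ≈ q
reflexive _ _ refl i j = refl

proposition6p3 : (∃₂ λ (H₁ H₂ : Hypergraph) →
    FourUniform H₁ × FourUniform H₂ × SameParameters H₁ H₂ ×
    T-HG H₁ ≈ T-HG H₂ ×
    ¬ (𝒯 (polymatroid H₁) ≈ 𝒯 (polymatroid H₂)))
    ×
    (∃₂ λ (H₃ H₄ : Hypergraph) →
    FourUniform H₃ × FourUniform H₄ × SameParameters H₃ H₄ ×
    𝒯 (polymatroid H₃) ≈ 𝒯 (polymatroid H₄) ×
    ¬ (T-HG H₃ ≈ T-HG H₄))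
proposition6p3 =
  ( H₁ , H₂ , toWitness {a? = fourUniform? H₁} tt , toWitness {a? = fourUniform? H₂} tt
  , record { same-v = refl ; same-κ = refl ; same-m = refl ; same-totalDegree = refl }
  , reflexive (T-HG H₁) (T-HG H₂) refl
  , λ eq → case eq 0 0 of λ ()
  ) ,
  ( H₃ , H₄ , toWitness {a? = fourUniform? H₃} tt , toWitness {a? = fourUniform? H₄} tt
  , record { same-v = refl ; same-κ = refl ; same-m = refl ; same-totalDegree = refl }
  , reflexive (𝒯 (polymatroid H₃)) (𝒯 (polymatroid H₄)) refl
  -- Exponent 0 of `y`, then 2 of `x`: only sets of rank 0 contribute. In `H₃` these are the empty
  -- set and the first hyperedge, giving 1 + (-1)³ = 0; in `H₄` only the empty set, giving 1.
  , λ eq → case eq 0 2 of λ ()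
  )
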